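{- Let $d,t\geq 2$ be integers and let $\mathcal{F}= \{(A^1_i, A^2_i,\ldots, A^d_i) : 1\leq i\leq t \}$ be a family of $t$ $d$-tuples of finite sets such that, for all $i,i'\in\{1,\dots,t\}$ and $j,j'\in\{1,\dots,d\}$, $A^j_i \cap A^{j'}_{i'}=\emptyset$ if and only if $i= i'$ and $j\neq j'$. Then $$\frac{d}{2}\, t\log_2 t \le \sum_{i=1}^{t}\sum_{j=1}^{d} |A^j_i|.$$
   Context: The superscript $j$ in $A_i^j$ is an index (position in the $d$-tuple), not a power. The property with $i=i'$, $j=j'$ says in particular that every $A_i^j$ is nonempty. -}

module Defs where

open import Data.Empty using (⊥)
open import Data.Integer.Base as ℤ using (ℤ; +_; +0; +[1+_]; -[1+_])
import Data.Integer.Properties as ℤ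
open import Data.Integer.Tactic.RingSolver using () renaming (solve-∀ to ℤ-solve-∀)
open import Data.List.Base using (List; length)
open import Data.List.Relation.Binary.Disjoint.Propositional using () renaming (Disjoint to Disjointᴸ)
open import Data.List.Relation.Unary.Unique.Propositional using (Unique)
open import Data.Nat.Base as ℕ using (ℕ; zero; suc; NonZero)
import Data.Nat.Properties as ℕ
open import Data.Nat.Tactic.RingSolver using (solve-∀)
open import Data.Product.Base using (_×_; _,_; ∃)
open import Data.Rational.Unnormalised.Base using (ℚᵘ; mkℚᵘ; _<_; _≃_; *<*; ↥_; ↧ₙ_; -_; _*_; 1/_; 0ℚᵘ; 1ℚᵘ; _/_; Positive)
import Data.Rational.Unnormalised.Base as ℚᵘ
import Data.Rational.Unnormalised.Properties as ℚ
open import Data.Sum.Base using (_⊎_; inj₁; inj₂)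
open import Function.Base using (_$_)
open import Level using (Level)
open import Relation.Binary.Definitions using (tri<; tri≈; tri>)
open import Relation.Binary.PropositionalEquality using (_≡_; refl; sym; trans; cong; cong₂; subst; subst₂)
open import Relation.Nullary using (yes; no)

private
  variable
    ℓ : Level

-- Finite sets of elements of an arbitrary type, presented by enumerations
-- without repetition, so that the cardinality is the length.

record FinSet (X : Set ℓ) : Set ℓ where
  field
    elements : List X
    unique   : Unique elements

open FinSet

∣_∣ : {X : Set ℓ} → FinSet X → ℕ
∣ A ∣ = length (elements A)

-- A ∩ B = ∅
Disjoint : {X : Set ℓ} → FinSet X → FinSet X → Set ℓ
Disjoint A B = Disjointᴸ (elements A) (elements B)

-- Two-sided Dedekind reals.  Lower q means q < x and Upper q means x < q.

record ℝ : Set₁ where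
  field
    Lower Upper     : ℚᵘ → Set
    lower-inhabited : ∃ Lower
    upper-inhabited : ∃ Upper
    lower-closed    : ∀ {q r} → q < r → Lower r → Lower q
    upper-closed    : ∀ {q r} → q < r → Upper q → Upper r
    lower-rounded   : ∀ {q} → Lower q → ∃ λ r → q < r × Lower r
    upper-rounded   : ∀ {r} → Upper r → ∃ λ q → q < r × Upper q
    disjoint        : ∀ {q} → Lower q → Upper q → ⊥
    located         : ∀ {q r} → q < r → Lower q ⊎ Upper r

  lower-resp : ∀ {q r} → q ≃ r → Lower q → Lower r
  lower-resp q≃r Lq with lower-rounded Lq
  ... | s , q<s , Ls = lower-closed (ℚ.<-respˡ-≃ q≃r q<s) Ls

  upper-resp : ∀ {q r} → q ≃ r → Upper q → Upper r
  upper-resp q≃r Uq with upper-rounded Uq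
  ... | s , s<q , Us = upper-closed (ℚ.<-respʳ-≃ q≃r s<q) Us

open ℝ

infix 4 _≤ℝ_

_≤ℝ_ : ℝ → ℝ → Set
x ≤ℝ y = ∀ {q} → Lower x q → Lower y q

fromℚ : ℚᵘ → ℝ
fromℚ p .Lower q = q < p
fromℚ p .Upper q = p < q
fromℚ p .lower-inhabited =
  p ℚᵘ.+ (- 1ℚᵘ) , ℚ.<-respʳ-≃ (ℚ.+-identityʳ p) (ℚ.+-monoʳ-< p (*<* ℤ.-<+))
fromℚ p .upper-inhabited =
  p ℚᵘ.+ 1ℚᵘ , ℚ.<-respˡ-≃ (ℚ.+-identityʳ p) (ℚ.+-monoʳ-< p (*<* (ℤ.+<+ ℕ.z<s)))
fromℚ p .lower-closed q<r r<p = ℚ.<-trans q<r r<p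
fromℚ p .upper-closed q<r p<q = ℚ.<-trans p<q q<r
fromℚ p .lower-rounded q<p with ℚ.<-dense q<p
... | m , q<m , m<p = m , q<m , m<p
fromℚ p .upper-rounded p<r with ℚ.<-dense p<r
... | m , p<m , m<r = m , m<r , p<m
fromℚ p .disjoint = ℚ.<-asym
fromℚ p .located {q} {r} q<r with ℚ.<-cmp q p
... | tri< q<p _ _ = inj₁ q<p
... | tri≈ _ q≃p _ = inj₂ (ℚ.<-respˡ-≃ q≃p q<r)
... | tri> _ _ p<q = inj₂ (ℚ.<-trans p<q q<r)

fromℕ : ℕ → ℝ
fromℕ n = fromℚ (+ n / 1)

-ℝ_ : ℝ → ℝ
(-ℝ x) .Lower q = Upper x (- q)
(-ℝ x) .Upper q = Lower x (- q)
(-ℝ x) .lower-inhabited with upper-inhabited x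
... | q , Uq = - q , upper-resp x (ℚ.≃-sym (ℚ.neg-involutive q)) Uq
(-ℝ x) .upper-inhabited with lower-inhabited x
... | q , Lq = - q , lower-resp x (ℚ.≃-sym (ℚ.neg-involutive q)) Lq
(-ℝ x) .lower-closed q<r = upper-closed x (ℚ.neg-mono-< q<r)
(-ℝ x) .upper-closed q<r = lower-closed x (ℚ.neg-mono-< q<r)
(-ℝ x) .lower-rounded {q} U with upper-rounded x U
... | s , s<-q , Us = - s
  , ℚ.<-respˡ-≃ (ℚ.neg-involutive q) (ℚ.neg-mono-< s<-q)
  , upper-resp x (ℚ.≃-sym (ℚ.neg-involutive s)) Us
(-ℝ x) .upper-rounded {q} L with lower-rounded x L
... | s , -q<s , Ls = - s
  , ℚ.<-respʳ-≃ (ℚ.neg-involutive q) (ℚ.neg-mono-< -q<s)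
  , lower-resp x (ℚ.≃-sym (ℚ.neg-involutive s)) Ls
(-ℝ x) .disjoint U L = disjoint x L U
(-ℝ x) .located q<r with located x (ℚ.neg-mono-< q<r)
... | inj₁ L = inj₂ L
... | inj₂ U = inj₁ U

-- The product of a positive rational c and a real x: q < c x iff q / c < x.

module _ (c : ℚᵘ) .{{c>0 : Positive c}} where
  private
    instance
      _ = ℚ.pos⇒nonZero c
      _ = ℚ.1/pos⇒pos c
      _ = ℚ.pos⇒nonNeg (1/ c) {{ℚ.1/pos⇒pos c}}

    cancel : ∀ q → 1/ c * (c * q) ≃ q
    cancel q = ℚ.≃-trans (ℚ.≃-sym (ℚ.*-assoc (1/ c) c q))
      (ℚ.≃-trans (ℚ.*-congʳ (ℚ.*-inverseˡ c)) (ℚ.*-identityˡ q))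

  scale⁺ : ℝ → ℝ
  scale⁺ x .Lower q = Lower x (1/ c * q)
  scale⁺ x .Upper q = Upper x (1/ c * q)
  scale⁺ x .lower-inhabited with lower-inhabited x
  ... | q , Lq = c * q , lower-resp x (ℚ.≃-sym (cancel q)) Lq
  scale⁺ x .upper-inhabited with upper-inhabited x
  ... | q , Uq = c * q , upper-resp x (ℚ.≃-sym (cancel q)) Uq
  scale⁺ x .lower-closed q<r = lower-closed x (ℚ.*-monoʳ-<-pos (1/ c) q<r)
  scale⁺ x .upper-closed q<r = upper-closed x (ℚ.*-monoʳ-<-pos (1/ c) q<r)
  scale⁺ x .lower-rounded L with lower-rounded x L
  ... | s , q<s , Ls = c * s
    , ℚ.*-cancelˡ-<-nonNeg (1/ c) (ℚ.<-respʳ-≃ (ℚ.≃-sym (cancel s)) q<s)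
    , lower-resp x (ℚ.≃-sym (cancel s)) Ls
  scale⁺ x .upper-rounded U with upper-rounded x U
  ... | s , s<q , Us = c * s
    , ℚ.*-cancelˡ-<-nonNeg (1/ c) (ℚ.<-respˡ-≃ (ℚ.≃-sym (cancel s)) s<q)
    , upper-resp x (ℚ.≃-sym (cancel s)) Us
  scale⁺ x .disjoint = disjoint x
  scale⁺ x .located q<r = located x (ℚ.*-monoʳ-<-pos (1/ c) q<r)

infixr 7 _•_

_•_ : ℚᵘ → ℝ → ℝ
mkℚᵘ +0 _           • x = fromℚ 0ℚᵘ
c@(mkℚᵘ +[1+ _ ] _) • x = scale⁺ c x
c@(mkℚᵘ -[1+ _ ] _) • x = -ℝ scale⁺ (- c) x

-- The positive and negative parts of an integer: p = p ⁺ - p ⁻.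

_⁺ _⁻ : ℤ → ℕ
(+ n) ⁺    = n
-[1+ n ] ⁺ = 0
p ⁻        = (ℤ.- p) ⁺

-- 2^q < n and n < 2^q for rational q = p / m, with denominators and negative
-- exponents cleared: 2^(p/m) < n iff 2^(p ⁺) < n^m 2^(p ⁻).

2^_<_ : ℚᵘ → ℕ → Set
2^ q < n = 2 ℕ.^ (↥ q) ⁺ ℕ.< n ℕ.^ ↧ₙ q ℕ.* 2 ℕ.^ (↥ q) ⁻

_<2^_ : ℕ → ℚᵘ → Set
n <2^ q = n ℕ.^ ↧ₙ q ℕ.* 2 ℕ.^ (↥ q) ⁻ ℕ.< 2 ℕ.^ (↥ q) ⁺

private
  parts : ∀ p → p ≡ + (p ⁺) ℤ.- + (p ⁻)
  parts +0       = refl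
  parts +[1+ n ] = sym (ℤ.+-identityʳ +[1+ n ])
  parts -[1+ n ] = refl

  shift : ∀ a b m b′ m′ →
    (a ℤ.- b) ℤ.* m′ ℤ.+ (b ℤ.* m′ ℤ.+ b′ ℤ.* m) ≡ a ℤ.* m′ ℤ.+ b′ ℤ.* m
  shift = ℤ-solve-∀

  shift′ : ∀ b m a′ b′ m′ →
    (a′ ℤ.- b′) ℤ.* m ℤ.+ (b ℤ.* m′ ℤ.+ b′ ℤ.* m) ≡ a′ ℤ.* m ℤ.+ b ℤ.* m′
  shift′ = ℤ-solve-∀

  pos-lin : ∀ a m b n → + a ℤ.* + m ℤ.+ + b ℤ.* + n ≡ + (a ℕ.* m ℕ.+ b ℕ.* n)
  pos-lin a m b n = sym (trans (ℤ.pos-+ (a ℕ.* m) (b ℕ.* n)) (cong₂ ℤ._+_ (ℤ.pos-* a m) (ℤ.pos-* b n)))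

  cross : ∀ a b m a′ b′ m′ → (+ a ℤ.- + b) ℤ.* + m′ ℤ.< (+ a′ ℤ.- + b′) ℤ.* + m →
    a ℕ.* m′ ℕ.+ b′ ℕ.* m ℕ.< a′ ℕ.* m ℕ.+ b ℕ.* m′
  cross a b m a′ b′ m′ lt = ℤ.drop‿+<+ $ subst₂ ℤ._<_
    (trans (shift (+ a) (+ b) (+ m) (+ b′) (+ m′)) (pos-lin a m′ b′ m))
    (trans (shift′ (+ b) (+ m) (+ a′) (+ b′) (+ m′)) (pos-lin a′ m b m′))
    (ℤ.+-monoˡ-< (+ b ℤ.* + m′ ℤ.+ + b′ ℤ.* + m) lt)

  cross⁻¹ : ∀ a b m a′ b′ m′ → a ℕ.* m′ ℕ.+ b′ ℕ.* m ℕ.< a′ ℕ.* m ℕ.+ b ℕ.* m′ →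
    (+ a ℤ.- + b) ℤ.* + m′ ℤ.< (+ a′ ℤ.- + b′) ℤ.* + m
  cross⁻¹ a b m a′ b′ m′ lt = ℤ.≰⇒> λ ge → ℕ.<⇒≱ lt $ ℤ.drop‿+≤+ $ subst₂ ℤ._≤_
    (trans (shift′ (+ b) (+ m) (+ a′) (+ b′) (+ m′)) (pos-lin a′ m b m′))
    (trans (shift (+ a) (+ b) (+ m) (+ b′) (+ m′)) (pos-lin a m′ b′ m))
    (ℤ.+-monoˡ-≤ (+ b ℤ.* + m′ ℤ.+ + b′ ℤ.* + m) ge)

  ^-distribʳ-* : ∀ k x y → (x ℕ.* y) ℕ.^ k ≡ x ℕ.^ k ℕ.* y ℕ.^ k
  ^-distribʳ-* zero    x y = refl
  ^-distribʳ-* (suc k) x y = trans (cong (x ℕ.* y ℕ.*_) (^-distribʳ-* k x y)) (lemma x y (x ℕ.^ k) (y ℕ.^ k))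
    where
    lemma : ∀ x y u v → x ℕ.* y ℕ.* (u ℕ.* v) ≡ x ℕ.* u ℕ.* (y ℕ.* v)
    lemma = solve-∀

  X^k : ∀ n m b k → (n ℕ.^ m ℕ.* 2 ℕ.^ b) ℕ.^ k ≡ n ℕ.^ (m ℕ.* k) ℕ.* 2 ℕ.^ (b ℕ.* k)
  X^k n m b k = trans (^-distribʳ-* k (n ℕ.^ m) (2 ℕ.^ b))
    (cong₂ ℕ._*_ (ℕ.^-*-assoc n m k) (ℕ.^-*-assoc 2 b k))

  2^-cancel-≤ : ∀ {x y} → 2 ℕ.^ x ℕ.≤ 2 ℕ.^ y → x ℕ.≤ y
  2^-cancel-≤ {x} {y} le = ℕ.≮⇒≥ λ y<x → ℕ.<⇒≱ (ℕ.^-monoʳ-< 2 ℕ.≤-refl y<x) le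

  -- If n ≤ 2^((a - b)/m) and 2^((a′ - b′)/m′) ≤ n then (a′ - b′)/m′ ≤ (a - b)/m.
  compare : ∀ n .{{_ : NonZero n}} a b m a′ b′ m′ →
    n ℕ.^ m ℕ.* 2 ℕ.^ b ℕ.≤ 2 ℕ.^ a → 2 ℕ.^ a′ ℕ.≤ n ℕ.^ m′ ℕ.* 2 ℕ.^ b′ →
    a′ ℕ.* m ℕ.+ b ℕ.* m′ ℕ.≤ a ℕ.* m′ ℕ.+ b′ ℕ.* m
  compare n a b m a′ b′ m′ h h′ = 2^-cancel-≤ $
    ℕ.*-cancelˡ-≤ (n ℕ.^ (m ℕ.* m′)) {{ℕ.m^n≢0 n (m ℕ.* m′)}} $ begin
    n ℕ.^ (m ℕ.* m′) ℕ.* 2 ℕ.^ (a′ ℕ.* m ℕ.+ b ℕ.* m′)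
      ≡⟨ cong (n ℕ.^ (m ℕ.* m′) ℕ.*_) (ℕ.^-distribˡ-+-* 2 (a′ ℕ.* m) (b ℕ.* m′)) ⟩
    n ℕ.^ (m ℕ.* m′) ℕ.* (2 ℕ.^ (a′ ℕ.* m) ℕ.* 2 ℕ.^ (b ℕ.* m′))
      ≡⟨ swap (n ℕ.^ (m ℕ.* m′)) (2 ℕ.^ (a′ ℕ.* m)) (2 ℕ.^ (b ℕ.* m′)) ⟩
    n ℕ.^ (m ℕ.* m′) ℕ.* 2 ℕ.^ (b ℕ.* m′) ℕ.* 2 ℕ.^ (a′ ℕ.* m)
      ≡⟨ cong₂ ℕ._*_ (X^k n m b m′) (ℕ.^-*-assoc 2 a′ m) ⟨
    (n ℕ.^ m ℕ.* 2 ℕ.^ b) ℕ.^ m′ ℕ.* (2 ℕ.^ a′) ℕ.^ m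
      ≤⟨ ℕ.*-mono-≤ (ℕ.^-monoˡ-≤ m′ h) (ℕ.^-monoˡ-≤ m h′) ⟩
    (2 ℕ.^ a) ℕ.^ m′ ℕ.* (n ℕ.^ m′ ℕ.* 2 ℕ.^ b′) ℕ.^ m
      ≡⟨ cong₂ ℕ._*_ (ℕ.^-*-assoc 2 a m′) (X^k n m′ b′ m) ⟩
    2 ℕ.^ (a ℕ.* m′) ℕ.* (n ℕ.^ (m′ ℕ.* m) ℕ.* 2 ℕ.^ (b′ ℕ.* m))
      ≡⟨ cong (λ e → 2 ℕ.^ (a ℕ.* m′) ℕ.* (n ℕ.^ e ℕ.* 2 ℕ.^ (b′ ℕ.* m))) (ℕ.*-comm m′ m) ⟩
    2 ℕ.^ (a ℕ.* m′) ℕ.* (n ℕ.^ (m ℕ.* m′) ℕ.* 2 ℕ.^ (b′ ℕ.* m))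
      ≡⟨ swap′ (2 ℕ.^ (a ℕ.* m′)) (n ℕ.^ (m ℕ.* m′)) (2 ℕ.^ (b′ ℕ.* m)) ⟩
    n ℕ.^ (m ℕ.* m′) ℕ.* (2 ℕ.^ (a ℕ.* m′) ℕ.* 2 ℕ.^ (b′ ℕ.* m))
      ≡⟨ cong (n ℕ.^ (m ℕ.* m′) ℕ.*_) (ℕ.^-distribˡ-+-* 2 (a ℕ.* m′) (b′ ℕ.* m)) ⟨
    n ℕ.^ (m ℕ.* m′) ℕ.* 2 ℕ.^ (a ℕ.* m′ ℕ.+ b′ ℕ.* m) ∎
    where
    open ℕ.≤-Reasoning
    swap : ∀ x y z → x ℕ.* (y ℕ.* z) ≡ x ℕ.* z ℕ.* y
    swap = solve-∀
    swap′ : ∀ x y z → x ℕ.* (y ℕ.* z) ≡ y ℕ.* (x ℕ.* z)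
    swap′ = solve-∀

  no-cross : ∀ n .{{_ : NonZero n}} {q r} → q < r →
    n ℕ.^ ↧ₙ q ℕ.* 2 ℕ.^ (↥ q) ⁻ ℕ.≤ 2 ℕ.^ (↥ q) ⁺ →
    2 ℕ.^ (↥ r) ⁺ ℕ.≤ n ℕ.^ ↧ₙ r ℕ.* 2 ℕ.^ (↥ r) ⁻ → ⊥
  no-cross n {mkℚᵘ p k} {mkℚᵘ p′ k′} (*<* lt) h h′ = ℕ.<⇒≱
    (cross (p ⁺) (p ⁻) (suc k) (p′ ⁺) (p′ ⁻) (suc k′)
      (subst₂ (λ x y → x ℤ.* + suc k′ ℤ.< y ℤ.* + suc k) (parts p) (parts p′) lt))
    (compare n (p ⁺) (p ⁻) (suc k) (p′ ⁺) (p′ ⁻) (suc k′) h h′)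

  bernoulli : ∀ A k → A ℕ.^ k ℕ.* (A ℕ.+ k) ℕ.≤ A ℕ.* suc A ℕ.^ k
  bernoulli A zero    = ℕ.≤-reflexive (lemma A)
    where
    lemma : ∀ A → 1 ℕ.* (A ℕ.+ 0) ≡ A ℕ.* 1
    lemma = solve-∀
  bernoulli A (suc k) = begin
    A ℕ.* A ℕ.^ k ℕ.* (A ℕ.+ suc k)             ≤⟨ ℕ.m≤m+n _ (A ℕ.^ k ℕ.* k) ⟩
    A ℕ.* A ℕ.^ k ℕ.* (A ℕ.+ suc k) ℕ.+ A ℕ.^ k ℕ.* k ≡⟨ lemma A (A ℕ.^ k) k ⟩
    A ℕ.^ k ℕ.* (A ℕ.+ k) ℕ.* suc A             ≤⟨ ℕ.*-monoˡ-≤ (suc A) (bernoulli A k) ⟩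
    A ℕ.* suc A ℕ.^ k ℕ.* suc A                 ≡⟨ lemma′ A (suc A ℕ.^ k) (suc A) ⟩
    A ℕ.* (suc A ℕ.* suc A ℕ.^ k)               ∎
    where
    open ℕ.≤-Reasoning
    lemma : ∀ A P k → A ℕ.* P ℕ.* (A ℕ.+ (1 ℕ.+ k)) ℕ.+ P ℕ.* k ≡ P ℕ.* (A ℕ.+ k) ℕ.* (1 ℕ.+ A)
    lemma = solve-∀
    lemma′ : ∀ A P B → A ℕ.* P ℕ.* B ≡ A ℕ.* (B ℕ.* P)
    lemma′ = solve-∀

  doubling : ∀ A .{{_ : NonZero A}} B → A ℕ.< B → 2 ℕ.* A ℕ.^ suc A ℕ.< B ℕ.^ suc A
  doubling A B A<B = ℕ.<-≤-trans (ℕ.*-cancelˡ-< A _ _ step) (ℕ.^-monoˡ-≤ (suc A) A<B)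
    where
    open ℕ.≤-Reasoning
    lemma : ∀ A P → A ℕ.* (2 ℕ.* P) ≡ P ℕ.* (A ℕ.+ A)
    lemma = solve-∀
    step : A ℕ.* (2 ℕ.* A ℕ.^ suc A) ℕ.< A ℕ.* suc A ℕ.^ suc A
    step = begin-strict
      A ℕ.* (2 ℕ.* A ℕ.^ suc A)       ≡⟨ lemma A (A ℕ.^ suc A) ⟩
      A ℕ.^ suc A ℕ.* (A ℕ.+ A)       <⟨ ℕ.*-monoʳ-< (A ℕ.^ suc A) {{ℕ.m^n≢0 A (suc A)}} (ℕ.+-monoʳ-< A (ℕ.n<1+n A)) ⟩
      A ℕ.^ suc A ℕ.* (A ℕ.+ suc A)   ≤⟨ bernoulli A (suc A) ⟩
      A ℕ.* suc A ℕ.^ suc A           ∎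

  parts-unique : ∀ a b → let p = + a ℤ.- + b in a ℕ.+ p ⁻ ≡ p ⁺ ℕ.+ b
  parts-unique a b = ℤ.+-injective $
    trans (ℤ.pos-+ a (p ⁻)) $ trans (lemma (+ a) (+ b) (+ (p ⁻))) $
    trans (cong (λ z → z ℤ.+ (+ b ℤ.+ + (p ⁻))) (parts p)) $
    trans (lemma′ (+ (p ⁺)) (+ b) (+ (p ⁻))) (sym (ℤ.pos-+ (p ⁺) b))
    where
    p = + a ℤ.- + b
    lemma : ∀ x y z → x ℤ.+ z ≡ (x ℤ.- y) ℤ.+ (y ℤ.+ z)
    lemma = ℤ-solve-∀
    lemma′ : ∀ x y z → (x ℤ.- z) ℤ.+ (y ℤ.+ z) ≡ x ℤ.+ y
    lemma′ = ℤ-solve-∀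

  -- The comparisons do not depend on how the numerator is written as a - b.
  module _ (Y a b : ℕ) where
    private
      p : ℤ
      p = + a ℤ.- + b

      move : 2 ℕ.^ p ⁺ ℕ.* 2 ℕ.^ b ≡ 2 ℕ.^ a ℕ.* 2 ℕ.^ p ⁻
      move = trans (sym (ℕ.^-distribˡ-+-* 2 (p ⁺) b))
        (trans (cong (2 ℕ.^_) (sym (parts-unique a b))) (ℕ.^-distribˡ-+-* 2 a (p ⁻)))

      swap : ∀ x y z → x ℕ.* y ℕ.* z ≡ x ℕ.* z ℕ.* y
      swap = solve-∀

    rep-lower : 2 ℕ.^ a ℕ.< Y ℕ.* 2 ℕ.^ b → 2 ℕ.^ p ⁺ ℕ.< Y ℕ.* 2 ℕ.^ p ⁻
    rep-lower h = ℕ.*-cancelʳ-< (2 ℕ.^ b) _ _ $ subst₂ ℕ._<_ (sym move) (swap Y (2 ℕ.^ b) (2 ℕ.^ p ⁻))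
      (ℕ.*-monoˡ-< (2 ℕ.^ p ⁻) {{ℕ.m^n≢0 2 (p ⁻)}} h)

    rep-upper : Y ℕ.* 2 ℕ.^ b ℕ.< 2 ℕ.^ a → Y ℕ.* 2 ℕ.^ p ⁻ ℕ.< 2 ℕ.^ p ⁺
    rep-upper h = ℕ.*-cancelʳ-< (2 ℕ.^ b) _ _ $ subst₂ ℕ._<_ (swap Y (2 ℕ.^ b) (2 ℕ.^ p ⁻)) (sym move)
      (ℕ.*-monoˡ-< (2 ℕ.^ p ⁻) {{ℕ.m^n≢0 2 (p ⁻)}} h)

  log-lower-rounded : ∀ n {q} → 2^ q < n → ∃ λ r → q < r × 2^ r < n
  log-lower-rounded n {mkℚᵘ p k} h = r , *<* q<r , rep-lower (n ℕ.^ (m ℕ.* N)) (suc (a ℕ.* N)) (b ℕ.* N) bound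
    where
    a = p ⁺ ; b = p ⁻ ; m = suc k ; N = suc (2 ℕ.^ a)
    r = (+ suc (a ℕ.* N) ℤ.- + (b ℕ.* N)) / (m ℕ.* N)
    lemma : ∀ a b m N → 1 ℕ.* m ℕ.+ (a ℕ.* (m ℕ.* N) ℕ.+ b ℕ.* N ℕ.* m) ≡ (1 ℕ.+ a ℕ.* N) ℕ.* m ℕ.+ b ℕ.* (m ℕ.* N)
    lemma = solve-∀
    q<r : p ℤ.* + (m ℕ.* N) ℤ.< (+ suc (a ℕ.* N) ℤ.- + (b ℕ.* N)) ℤ.* + m
    q<r = subst (λ x → x ℤ.* + (m ℕ.* N) ℤ.< (+ suc (a ℕ.* N) ℤ.- + (b ℕ.* N)) ℤ.* + m) (sym (parts p))
      (cross⁻¹ a b m (suc (a ℕ.* N)) (b ℕ.* N) (m ℕ.* N)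
        (subst (a ℕ.* (m ℕ.* N) ℕ.+ b ℕ.* N ℕ.* m ℕ.<_) (lemma a b m N) (ℕ.m<n+m _ {1 ℕ.* m} ℕ.z<s)))
    bound : 2 ℕ.^ suc (a ℕ.* N) ℕ.< n ℕ.^ (m ℕ.* N) ℕ.* 2 ℕ.^ (b ℕ.* N)
    bound = subst₂ ℕ._<_ (cong (2 ℕ.*_) (ℕ.^-*-assoc 2 a N)) (X^k n m b N)
      (doubling (2 ℕ.^ a) {{ℕ.m^n≢0 2 a}} _ h)

  log-upper-rounded : ∀ n .{{_ : NonZero n}} {r} → n <2^ r → ∃ λ q → q < r × n <2^ q
  log-upper-rounded n {mkℚᵘ p k} h = q , *<* q<r , rep-upper (n ℕ.^ (m ℕ.* N)) (a ℕ.* N) (suc (b ℕ.* N)) bound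
    where
    a = p ⁺ ; b = p ⁻ ; m = suc k ; X = n ℕ.^ m ℕ.* 2 ℕ.^ b ; N = suc X
    instance
      X≢0 : NonZero X
      X≢0 = ℕ.m*n≢0 (n ℕ.^ m) (2 ℕ.^ b) {{ℕ.m^n≢0 n m}} {{ℕ.m^n≢0 2 b}}
    q = (+ (a ℕ.* N) ℤ.- + suc (b ℕ.* N)) / (m ℕ.* N)
    lemma : ∀ a b m N → 1 ℕ.* m ℕ.+ (a ℕ.* N ℕ.* m ℕ.+ b ℕ.* (m ℕ.* N)) ≡ a ℕ.* (m ℕ.* N) ℕ.+ (1 ℕ.+ b ℕ.* N) ℕ.* m
    lemma = solve-∀
    q<r : (+ (a ℕ.* N) ℤ.- + suc (b ℕ.* N)) ℤ.* + m ℤ.< p ℤ.* + (m ℕ.* N)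
    q<r = subst (λ x → (+ (a ℕ.* N) ℤ.- + suc (b ℕ.* N)) ℤ.* + m ℤ.< x ℤ.* + (m ℕ.* N)) (sym (parts p))
      (cross⁻¹ (a ℕ.* N) (suc (b ℕ.* N)) (m ℕ.* N) a b m
        (subst (a ℕ.* N ℕ.* m ℕ.+ b ℕ.* (m ℕ.* N) ℕ.<_) (lemma a b m N) (ℕ.m<n+m _ {1 ℕ.* m} ℕ.z<s)))
    swap : ∀ x y → 2 ℕ.* (x ℕ.* y) ≡ x ℕ.* (2 ℕ.* y)
    swap = solve-∀
    bound : n ℕ.^ (m ℕ.* N) ℕ.* 2 ℕ.^ suc (b ℕ.* N) ℕ.< 2 ℕ.^ (a ℕ.* N)
    bound = subst₂ ℕ._<_
      (trans (cong (2 ℕ.*_) (X^k n m b N)) (swap (n ℕ.^ (m ℕ.* N)) (2 ℕ.^ (b ℕ.* N))))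
      (ℕ.^-*-assoc 2 a N)
      (doubling X _ h)

  n<2^n : ∀ n → n ℕ.< 2 ℕ.^ n
  n<2^n zero    = ℕ.z<s
  n<2^n (suc n) = ℕ.+-mono-≤ (ℕ.m^n>0 2 n) (ℕ.≤-trans (n<2^n n) (ℕ.m≤m+n _ 0))

log₂ : (n : ℕ) → .{{NonZero n}} → ℝ
log₂ n .Lower q = 2^ q < n
log₂ n .Upper q = n <2^ q
log₂ n .lower-inhabited = - 1ℚᵘ , ℕ.*-mono-≤ (ℕ.m^n>0 n 1) ℕ.≤-refl
log₂ n .upper-inhabited = + n / 1 , subst (ℕ._< 2 ℕ.^ n) (sym n^1*2^0≡n) (n<2^n n)
  where
  n^1*2^0≡n : n ℕ.^ 1 ℕ.* 2 ℕ.^ (+ n) ⁻ ≡ n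
  n^1*2^0≡n = trans (cong (λ e → n ℕ.^ 1 ℕ.* 2 ℕ.^ e) (neg-part n))
    (trans (ℕ.*-identityʳ (n ℕ.^ 1)) (ℕ.^-identityʳ n))
    where
    neg-part : ∀ n → (+ n) ⁻ ≡ 0
    neg-part zero    = refl
    neg-part (suc _) = refl
log₂ n .lower-closed q<r h = ℕ.≰⇒> λ h′ → no-cross n q<r h′ (ℕ.<⇒≤ h)
log₂ n .upper-closed q<r h = ℕ.≰⇒> λ h′ → no-cross n q<r (ℕ.<⇒≤ h) h′
log₂ n .lower-rounded = log-lower-rounded n
log₂ n .upper-rounded = log-upper-rounded n
log₂ n .disjoint = ℕ.<-asym
log₂ n .located {q} q<r with 2 ℕ.^ (↥ q) ⁺ ℕ.<? n ℕ.^ ↧ₙ q ℕ.* 2 ℕ.^ (↥ q) ⁻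
... | yes h = inj₁ h
... | no ¬h = inj₂ (ℕ.≰⇒> (no-cross n q<r (ℕ.≮⇒≥ ¬h)))

{-# OPTIONS --safe #-}

-- Fix positions j ≠ k, put P i = A i j and Q i = A i k, and choose a uniformly
-- random subset Y of the ground set.  The events "P i ⊆ Y and Q i ∩ Y = ∅" are
-- pairwise exclusive because P i meets Q i′ for i ≠ i′, and the i-th one has
-- probability 2^-(|P i| + |Q i|).  Hence these probabilities sum to at most 1, and
-- AM-GM gives t^t ≤ 2^(S j + S k), where S j = ∑ᵢ |A i j|.  Multiplying this over
-- the d cyclically consecutive pairs of positions counts every S j twice, so
-- t^(t d) ≤ 2^(2 ∑ⱼ S j).
--
-- Equality on X need not be decidable, but t^t ≤ 2^(S j + S k) is, so the
-- membership questions in its proof may be decided under a double negation.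

module Submission where

open import Defs using (FinSet; ∣_∣; Disjoint; _≤ℝ_; _•_; log₂; fromℕ; module FinSet; module ℝ)
open import Algebra.Properties.CommutativeMonoid.Sum using () renaming (sum to fold; ∑-distrib-+ to fold-distrib)
open import Data.Bool.Base using (Bool; true; false)
open import Data.Empty using (⊥; ⊥-elim)
open import Data.Fin.Base using (Fin; zero; suc; inject₁)
import Data.Fin.Base as Fin
open import Data.Fin.Properties using (sequence; suc-injective)
open import Data.Integer.Base using (+_; -[1+_]; +0; +[1+_])
import Data.Integer.Base as ℤ
import Data.Integer.Properties as ℤ
open import Data.List.Base using (List; []; _∷_; _++_; length; concat; lookup)
import Data.List.Base as List
open import Data.List.Membership.Propositional using (_∈_)
open import Data.List.Membership.Propositional.Properties using (∈-++⁺ˡ; ∈-++⁺ʳ; ∈-∃++; ∈-concat⁺′; ∈-tabulate⁺; ∈-lookup)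
open import Data.List.Properties using (length-++)
open import Data.List.Relation.Binary.Disjoint.Propositional using () renaming (Disjoint to Disjointᴸ)
open import Data.List.Relation.Binary.Permutation.Propositional.Properties using (shift; ↭-length; ∈-resp-↭)
open import Data.List.Relation.Binary.Subset.Propositional using (_⊆_)
import Data.List.Relation.Unary.All as All
open import Data.List.Relation.Unary.All.Properties using (¬Any⇒All¬)
open import Data.List.Relation.Unary.AllPairs using ([]; _∷_)
open import Data.List.Relation.Unary.Any using (here; there; index)
open import Data.List.Relation.Unary.Any.Properties using (lookup-index)
open import Data.List.Relation.Unary.Unique.Propositional using (Unique)
open import Data.Maybe.Base using (Maybe; just; nothing)
open import Data.Nat.Base using (ℕ; zero; suc; _+_; _^_; _≤_; _<_; z≤n; s≤s; NonZero; >-nonZero)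
import Data.Nat.Base as ℕ
open import Data.Nat.Properties hiding (suc-injective)
open import Algebra.Properties.CommutativeMonoid.Sum +-0-commutativeMonoid using (sum; sum-syntax; ∑-distrib-+; ∑-comm; sum-cong-≗; sum-init-last; sum-replicate-zero)
open import Data.Nat.Tactic.RingSolver using (solve-∀)
open import Data.Product.Base using (_×_; _,_; proj₁; ∃)
open import Data.Rational.Unnormalised.Base using (mkℚᵘ; *<*; _/_; _*_)
import Data.Rational.Unnormalised.Base as ℚ
open import Data.Sum.Base using (inj₁; inj₂)
open import Data.Vec.Base as Vec using (Vec; []; _∷_)
open import Effect.Monad using (RawMonad)
open import Function.Base using (_∘_; _$_)
open import Function.Bundles using (_⇔_; module Equivalence)
open import Level using (Level)
open import Relation.Binary.PropositionalEquality using (_≡_; _≢_; refl; sym; trans; cong; cong₂; subst; subst₂; module ≡-Reasoning)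
open import Relation.Nullary using (¬_; Dec; yes; no; contradiction)
open import Relation.Nullary.Decidable using (decidable-stable; ¬¬-excluded-middle)
open import Relation.Nullary.Negation using (¬¬-Monad)

open FinSet using (elements)
open ℝ using (Lower)

private
  variable
    ℓ : Level
    n t N : ℕ

-- Sums and products of naturals

∏ : (Fin n → ℕ) → ℕ
∏ = fold *-1-commutativeMonoid

∏-const : ∀ n K → ∏ {n} (λ _ → K) ≡ K ^ n
∏-const zero    K = refl
∏-const (suc n) K = cong (K ℕ.*_) (∏-const n K)

∏-^ : ∀ a (s : Fin n → ℕ) → ∏ (λ i → a ^ s i) ≡ a ^ sum s
∏-^ {zero}  a s = refl
∏-^ {suc n} a s = trans (cong (a ^ s zero ℕ.*_) (∏-^ a (s ∘ suc)))
  (sym (^-distribˡ-+-* a (s zero) (sum (s ∘ suc))))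

∏-cong : {f g : Fin n → ℕ} → (∀ i → f i ≡ g i) → ∏ f ≡ ∏ g
∏-cong {zero}  eq = refl
∏-cong {suc n} eq = cong₂ ℕ._*_ (eq zero) (∏-cong (eq ∘ suc))

∏-mono-≤ : {f g : Fin n → ℕ} → (∀ i → f i ≤ g i) → ∏ f ≤ ∏ g
∏-mono-≤ {zero}  le = ≤-refl
∏-mono-≤ {suc n} le = *-mono-≤ (le zero) (∏-mono-≤ (le ∘ suc))

∏≢0 : (f : Fin n → ℕ) → (∀ i → NonZero (f i)) → NonZero (∏ f)
∏≢0 {zero}  f nz = _
∏≢0 {suc n} f nz = m*n≢0 (f zero) (∏ (f ∘ suc)) {{nz zero}} {{∏≢0 (f ∘ suc) (nz ∘ suc)}}

∑-mono-≤ : {f g : Fin n → ℕ} → (∀ i → f i ≤ g i) → sum f ≤ sum g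
∑-mono-≤ {zero}  le = ≤-refl
∑-mono-≤ {suc n} le = +-mono-≤ (le zero) (∑-mono-≤ (le ∘ suc))

^-sum-bound : ∀ K (g : Fin n → ℕ) → (∀ j → K ≤ 2 ^ g j) → K ^ n ≤ 2 ^ sum g
^-sum-bound {n} K g le = subst₂ _≤_ (∏-const n K) (∏-^ 2 g) (∏-mono-≤ le)

∑-at-most-one : (f : Fin n → ℕ) → (∀ i → f i ≤ 1) →
  (∀ i j → i ≢ j → f i ≢ 0 → f j ≢ 0 → ⊥) → sum f ≤ 1
∑-at-most-one {zero}  f f≤1 excl = z≤n
∑-at-most-one {suc n} f f≤1 excl with f zero ≟ 0
... | yes f0≡0 = subst (λ z → z + sum (f ∘ suc) ≤ 1) (sym f0≡0)
  (∑-at-most-one (f ∘ suc) (f≤1 ∘ suc) λ i j i≢j → excl (suc i) (suc j) (i≢j ∘ suc-injective))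
... | no f0≢0 = subst (λ z → f zero + z ≤ 1) (sym rest≡0)
  (subst (_≤ 1) (sym (+-identityʳ (f zero))) (f≤1 zero))
  where
  rest≡0 : sum (f ∘ suc) ≡ 0
  rest≡0 = trans
    (sum-cong-≗ λ i → decidable-stable (f (suc i) ≟ 0) (excl zero (suc i) (λ ()) f0≢0))
    (sum-replicate-zero n)

-- The inequality of arithmetic and geometric means

-- With `b = a + k` and `B = A + l` the two sides differ by exactly `k ℕ.* l`.
rearrangement-≤ : ∀ {a b A B} → a ≤ b → A ≤ B → a ℕ.* B + b ℕ.* A ≤ b ℕ.* B + a ℕ.* A
rearrangement-≤ {a} {_} {A} a≤b A≤B with m≤n⇒∃[o]m+o≡n a≤b | m≤n⇒∃[o]m+o≡n A≤B
... | k , refl | l , refl = ≤-trans (m≤m+n _ (k ℕ.* l)) (≤-reflexive (identity a k A l))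
  where
  identity : ∀ a k A l → a ℕ.* (A + l) + (a + k) ℕ.* A + k ℕ.* l ≡ (a + k) ℕ.* (A + l) + a ℕ.* A
  identity = solve-∀

rearrangement-^ : ∀ a b m → a ℕ.* b ^ m + b ℕ.* a ^ m ≤ b ℕ.* b ^ m + a ℕ.* a ^ m
rearrangement-^ a b m with ≤-total a b
... | inj₁ a≤b = rearrangement-≤ a≤b (^-monoˡ-≤ m a≤b)
... | inj₂ b≤a = subst₂ _≤_ (+-comm (b ℕ.* a ^ m) _) (+-comm (a ℕ.* a ^ m) _)
  (rearrangement-≤ b≤a (^-monoˡ-≤ m b≤a))

-- This is AM-GM for `b ^ suc n` and `n` copies of `a ^ suc n`. The induction step multiplies the
-- previous bound by `a` and adds `rearrangement-^`.
young : ∀ a b n → suc n ℕ.* (b ℕ.* a ^ n) ≤ b ^ suc n + n ℕ.* a ^ suc n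
young a b zero    = ≤-reflexive (identity b)
  where
  identity : ∀ b → 1 ℕ.* (b ℕ.* 1) ≡ b ℕ.* 1 + 0
  identity = solve-∀
-- The added term completes the left side of the rearrangement inequality and reappears on the right
-- when the induction hypothesis is multiplied by `a`.
young a b (suc n) = +-cancelˡ-≤ (a ℕ.* b ^ suc n) _ _ $ begin
  a ℕ.* b ^ suc n + suc (suc n) ℕ.* (b ℕ.* a ^ suc n)
    ≡⟨ before a b (a ^ n) (b ^ suc n) n ⟩
  a ℕ.* b ^ suc n + b ℕ.* a ^ suc n + a ℕ.* (suc n ℕ.* (b ℕ.* a ^ n))
    ≤⟨ +-mono-≤ (rearrangement-^ a b (suc n)) (*-monoʳ-≤ a (young a b n)) ⟩
  b ℕ.* b ^ suc n + a ℕ.* a ^ suc n + a ℕ.* (b ^ suc n + n ℕ.* a ^ suc n)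
    ≡⟨ after a b (a ^ suc n) (b ^ suc n) n ⟩
  a ℕ.* b ^ suc n + (b ℕ.* b ^ suc n + suc n ℕ.* (a ℕ.* a ^ suc n)) ∎
  where
  open ≤-Reasoning
  before : ∀ a b A B n → a ℕ.* B + (2 + n) ℕ.* (b ℕ.* (a ℕ.* A)) ≡ a ℕ.* B + b ℕ.* (a ℕ.* A) + a ℕ.* ((1 + n) ℕ.* (b ℕ.* A))
  before = solve-∀
  after : ∀ a b A B n → b ℕ.* B + a ℕ.* A + a ℕ.* (B + n ℕ.* A) ≡ a ℕ.* B + (b ℕ.* B + (1 + n) ℕ.* (a ℕ.* A))
  after = solve-∀

^-distribʳ-* : ∀ k x y → (x ℕ.* y) ^ k ≡ x ^ k ℕ.* y ^ k
^-distribʳ-* zero    x y = refl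
^-distribʳ-* (suc k) x y = trans (cong (x ℕ.* y ℕ.*_) (^-distribʳ-* k x y)) (interchange x y (x ^ k) (y ^ k))
  where
  interchange : ∀ x y u v → x ℕ.* y ℕ.* (u ℕ.* v) ≡ x ℕ.* u ℕ.* (y ℕ.* v)
  interchange = solve-∀

-- Young's inequality for the means S/n and (x + S)/(n + 1), scaled by n (n + 1).
mean-step : ∀ n .{{_ : NonZero n}} x S →
  suc n ^ suc n ℕ.* (x ℕ.* S ^ n) ≤ n ^ n ℕ.* (x + S) ^ suc n
mean-step n x S = *-cancelˡ-≤ n $ +-cancelʳ-≤ (n ℕ.* a ^ suc n) _ _ $ begin
  n ℕ.* (suc n ^ suc n ℕ.* (x ℕ.* S ^ n)) + n ℕ.* a ^ suc n
    ≡⟨ cong (λ z → n ℕ.* (suc n ^ suc n ℕ.* (x ℕ.* S ^ n)) + n ℕ.* (a ℕ.* z)) a^n ⟩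
  n ℕ.* (suc n ^ suc n ℕ.* (x ℕ.* S ^ n)) + n ℕ.* (a ℕ.* (suc n ^ n ℕ.* S ^ n))
    ≡⟨ before n x S (suc n ^ n) (S ^ n) ⟩
  suc n ℕ.* (b ℕ.* (suc n ^ n ℕ.* S ^ n))
    ≡⟨ cong (λ z → suc n ℕ.* (b ℕ.* z)) a^n ⟨
  suc n ℕ.* (b ℕ.* a ^ n)
    ≤⟨ young a b n ⟩
  b ^ suc n + n ℕ.* a ^ suc n
    ≡⟨ cong (_+ n ℕ.* a ^ suc n) (trans (^-distribʳ-* (suc n) n (x + S)) (*-assoc n (n ^ n) _)) ⟩
  n ℕ.* (n ^ n ℕ.* (x + S) ^ suc n) + n ℕ.* a ^ suc n ∎
  where
  open ≤-Reasoning
  a = suc n ℕ.* S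
  b = n ℕ.* (x + S)
  a^n : a ^ n ≡ suc n ^ n ℕ.* S ^ n
  a^n = ^-distribʳ-* n (suc n) S
  before : ∀ n x S M T →
    n ℕ.* ((1 + n) ℕ.* M ℕ.* (x ℕ.* T)) + n ℕ.* ((1 + n) ℕ.* S ℕ.* (M ℕ.* T)) ≡
    (1 + n) ℕ.* (n ℕ.* (x + S) ℕ.* (M ℕ.* T))
  before = solve-∀

-- Induction on the number of terms: the hypothesis handles all but the first, which `mean-step`
-- absorbs. One term is a separate base case because `mean-step` asks for a nonzero `n`.
am-gm : ∀ n (x : Fin n → ℕ) → n ^ n ℕ.* ∏ x ≤ sum x ^ n
am-gm zero          x = ≤-refl
am-gm (suc zero)    x = ≤-reflexive (identity (x zero))
  where
  identity : ∀ y → 1 ℕ.* (y ℕ.* 1) ≡ (y + 0) ℕ.* 1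
  identity = solve-∀
am-gm (suc n@(suc _)) x = *-cancelˡ-≤ (n ^ n) {{m^n≢0 n n}} $ begin
  n ^ n ℕ.* (suc n ^ suc n ℕ.* (x zero ℕ.* ∏ (x ∘ suc)))
    ≡⟨ swap (n ^ n) (suc n ^ suc n) (x zero) (∏ (x ∘ suc)) ⟩
  suc n ^ suc n ℕ.* (x zero ℕ.* (n ^ n ℕ.* ∏ (x ∘ suc)))
    ≤⟨ *-monoʳ-≤ (suc n ^ suc n) (*-monoʳ-≤ (x zero) (am-gm n (x ∘ suc))) ⟩
  suc n ^ suc n ℕ.* (x zero ℕ.* sum (x ∘ suc) ^ n)
    ≤⟨ mean-step n (x zero) (sum (x ∘ suc)) ⟩
  n ^ n ℕ.* sum x ^ suc n ∎
  where
  open ≤-Reasoning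
  swap : ∀ a b c d → a ℕ.* (b ℕ.* (c ℕ.* d)) ≡ b ℕ.* (c ℕ.* (a ℕ.* d))
  swap = solve-∀

-- The weights are `K` times 2^(-s i), so `sum w ≤ K` is a Kraft inequality. AM-GM bounds
-- `t ^ t ℕ.* ∏ w` by `K ^ t`, from which the nonzero factor `∏ w` cancels.
kraft⇒^-bound : ∀ K .{{_ : NonZero K}} (w s : Fin t → ℕ) →
  (∀ i → w i ℕ.* 2 ^ s i ≡ K) → sum w ≤ K → t ^ t ≤ 2 ^ sum s
kraft⇒^-bound {t} K w s w*2^s≡K ∑w≤K = *-cancelʳ-≤ _ _ (∏ w) {{∏≢0 w w≢0}} $ begin
  t ^ t ℕ.* ∏ w                   ≤⟨ am-gm t w ⟩
  sum w ^ t                       ≤⟨ ^-monoˡ-≤ t ∑w≤K ⟩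
  K ^ t                           ≡⟨ ∏-const t K ⟨
  ∏ {t} (λ _ → K)                 ≡⟨ ∏-cong w*2^s≡K ⟨
  ∏ (λ i → w i ℕ.* 2 ^ s i)       ≡⟨ fold-distrib *-1-commutativeMonoid w (λ i → 2 ^ s i) ⟩
  ∏ w ℕ.* ∏ (λ i → 2 ^ s i)       ≡⟨ cong (∏ w ℕ.*_) (∏-^ 2 s) ⟩
  ∏ w ℕ.* 2 ^ sum s               ≡⟨ *-comm (∏ w) (2 ^ sum s) ⟩
  2 ^ sum s ℕ.* ∏ w               ∎
  where
  open ≤-Reasoning
  w≢0 : ∀ i → NonZero (w i)
  w≢0 i = m*n≢0⇒m≢0 (w i) {{ℕ.≢-nonZero (subst (_≢ 0) (sym (w*2^s≡K i)) (ℕ.≢-nonZero⁻¹ K))}}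

-- Subcubes of the Boolean cube

∑cube : (Vec Bool N → ℕ) → ℕ
∑cube {zero}  f = f []
∑cube {suc N} f = ∑cube (f ∘ (true ∷_)) + ∑cube (f ∘ (false ∷_))

∑cube-≤2^ : (f : Vec Bool N → ℕ) → (∀ x → f x ≤ 1) → ∑cube f ≤ 2 ^ N
∑cube-≤2^ {zero}  f f≤1 = f≤1 []
∑cube-≤2^ {suc N} f f≤1 = subst (λ z → ∑cube f ≤ 2 ^ N + z) (sym (+-identityʳ (2 ^ N)))
  (+-mono-≤ (∑cube-≤2^ _ (f≤1 ∘ (true ∷_))) (∑cube-≤2^ _ (f≤1 ∘ (false ∷_))))

∑-∑cube-comm : (f : Fin t → Vec Bool N → ℕ) →
  ∑[ i < t ] ∑cube (f i) ≡ ∑cube (λ x → ∑[ i < t ] f i x)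
∑-∑cube-comm {N = zero}  f = refl
∑-∑cube-comm {N = suc N} f = trans (∑-distrib-+ (λ i → ∑cube (f i ∘ (true ∷_))) (λ i → ∑cube (f i ∘ (false ∷_))))
  (cong₂ _+_ (∑-∑cube-comm (λ i → f i ∘ (true ∷_))) (∑-∑cube-comm (λ i → f i ∘ (false ∷_))))

∑cube-* : ∀ k (f : Vec Bool N → ℕ) → ∑cube (λ x → k ℕ.* f x) ≡ k ℕ.* ∑cube f
∑cube-* {zero}  k f = refl
∑cube-* {suc N} k f = trans (cong₂ _+_ (∑cube-* k (f ∘ (true ∷_))) (∑cube-* k (f ∘ (false ∷_))))
  (sym (*-distribˡ-+ k (∑cube (f ∘ (true ∷_))) (∑cube (f ∘ (false ∷_)))))

-- A subcube prescribes some of the coordinates; nothing marks a free one.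
Subcube : ℕ → Set
Subcube N = Fin N → Maybe Bool

agrees : Maybe Bool → Bool → ℕ
agrees nothing      _     = 1
agrees (just true)  true  = 1
agrees (just true)  false = 0
agrees (just false) true  = 0
agrees (just false) false = 1

prescribed : Maybe Bool → ℕ
prescribed nothing  = 0
prescribed (just _) = 1

codim : Subcube N → ℕ
codim c = sum (prescribed ∘ c)

-- The indicator function, with values in `ℕ` so that volumes are sums over the cube.
χ : Subcube N → Vec Bool N → ℕ
χ c []      = 1
χ c (b ∷ x) = agrees (c zero) b ℕ.* χ (c ∘ suc) x

agrees≤1 : ∀ l b → agrees l b ≤ 1
agrees≤1 nothing      _     = ≤-refl
agrees≤1 (just true)  true  = ≤-refl
agrees≤1 (just true)  false = z≤n
agrees≤1 (just false) true  = z≤n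
agrees≤1 (just false) false = ≤-refl

χ≤1 : (c : Subcube N) → ∀ x → χ c x ≤ 1
χ≤1 c []      = ≤-refl
χ≤1 c (b ∷ x) = *-mono-≤ (agrees≤1 (c zero) b) (χ≤1 (c ∘ suc) x)

χ≢0⇒agrees≢0 : (c : Subcube N) → ∀ x → χ c x ≢ 0 → ∀ p → agrees (c p) (Vec.lookup x p) ≢ 0
χ≢0⇒agrees≢0 c (b ∷ x) χ≢0 zero    eq = χ≢0 (cong (ℕ._* χ (c ∘ suc) x) eq)
χ≢0⇒agrees≢0 c (b ∷ x) χ≢0 (suc p) = χ≢0⇒agrees≢0 (c ∘ suc) x
  (λ eq → χ≢0 (trans (cong (agrees (c zero) b ℕ.*_) eq) (*-zeroʳ (agrees (c zero) b)))) p

-- A free coordinate doubles the number of points; a prescribed one keeps a single half while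
-- `2 ^ codim c` gains a factor 2.
volume : (c : Subcube N) → ∑cube (χ c) ℕ.* 2 ^ codim c ≡ 2 ^ N
volume {zero}  c = refl
volume {suc N} c = begin
  ∑cube (χ c) ℕ.* 2 ^ codim c
    ≡⟨ cong (ℕ._* 2 ^ codim c) (cong₂ _+_ (∑cube-* (agrees (c zero) true) (χ c′)) (∑cube-* (agrees (c zero) false) (χ c′))) ⟩
  (agrees (c zero) true ℕ.* V + agrees (c zero) false ℕ.* V) ℕ.* 2 ^ (prescribed (c zero) + codim c′)
    ≡⟨ coordinate (c zero) V (codim c′) ⟩
  2 ℕ.* (V ℕ.* 2 ^ codim c′)
    ≡⟨ cong (2 ℕ.*_) (volume c′) ⟩
  2 ℕ.* 2 ^ N ∎
  where
  open ≡-Reasoning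
  c′ = c ∘ suc
  V = ∑cube (χ c′)
  free : ∀ V E → (1 ℕ.* V + 1 ℕ.* V) ℕ.* E ≡ 2 ℕ.* (V ℕ.* E)
  free = solve-∀
  up : ∀ V E → (1 ℕ.* V + 0 ℕ.* V) ℕ.* (2 ℕ.* E) ≡ 2 ℕ.* (V ℕ.* E)
  up = solve-∀
  down : ∀ V E → (0 ℕ.* V + 1 ℕ.* V) ℕ.* (2 ℕ.* E) ≡ 2 ℕ.* (V ℕ.* E)
  down = solve-∀
  coordinate : ∀ l V e → (agrees l true ℕ.* V + agrees l false ℕ.* V) ℕ.* 2 ^ (prescribed l + e) ≡ 2 ℕ.* (V ℕ.* 2 ^ e)
  coordinate nothing      V e = free V (2 ^ e)
  coordinate (just true)  V e = up V (2 ^ e)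
  coordinate (just false) V e = down V (2 ^ e)

-- At each point at most one indicator is nonzero, so the volumes sum to at most `2 ^ N` and serve
-- as Kraft weights.
exclusive-subcubes-bound : (c : Fin t → Subcube N) →
  (∀ i j → i ≢ j → ∀ x → χ (c i) x ≢ 0 → χ (c j) x ≢ 0 → ⊥) →
  t ^ t ≤ 2 ^ (∑[ i < t ] codim (c i))
exclusive-subcubes-bound {t} {N} c excl = kraft⇒^-bound (2 ^ N) {{m^n≢0 2 N}}
  (λ i → ∑cube (χ (c i))) (λ i → codim (c i)) (λ i → volume (c i)) $
  subst (_≤ 2 ^ N) (sym (∑-∑cube-comm (λ i → χ (c i)))) $
  ∑cube-≤2^ _ λ x → ∑-at-most-one (λ i → χ (c i) x) (λ i → χ≤1 (c i) x) λ i j i≢j → excl i j i≢j x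

-- Cross-intersecting families of lists

module _ {X : Set ℓ} where

  ¬¬-enumeration : (xs : List X) → ¬ ¬ ∃ λ U → Unique U × xs ⊆ U
  ¬¬-enumeration []       k = k ([] , [] , λ ())
  ¬¬-enumeration (x ∷ xs) k = ¬¬-enumeration xs λ where
    (U , U! , xs⊆U) → ¬¬-excluded-middle {A = x ∈ U} λ where
      (yes x∈U) → k (U , U! , λ { (here refl) → x∈U ; (there y∈xs) → xs⊆U y∈xs })
      (no x∉U)  → k (x ∷ U , ¬Any⇒All¬ U x∉U ∷ U! ,
        λ { (here refl) → here refl ; (there y∈xs) → there (xs⊆U y∈xs) })

  -- Distinct prescribed positions carry distinct elements of `zs`, since `U` has no repetition.
  -- Each one found is deleted from `zs` before the recursive call.
  codim≤length : (U : List X) → Unique U → (c : Subcube (length U)) (zs : List X) →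
    (∀ p → c p ≢ nothing → lookup U p ∈ zs) → codim c ≤ length zs
  codim≤length []      _          c zs c⊆zs = z≤n
  codim≤length (x ∷ U) (x∉U ∷ U!) c zs c⊆zs with c zero in c0
  ... | nothing = codim≤length U U! (c ∘ suc) zs (c⊆zs ∘ suc)
  ... | just _ with ∈-∃++ (c⊆zs zero λ eq → contradiction (trans (sym c0) eq) λ ())
  ...   | ys , ys′ , refl = subst (_ ≤_) (sym (↭-length (shift x ys ys′)))
    (s≤s (codim≤length U U! (c ∘ suc) (ys ++ ys′) remaining))
    where
    remaining : ∀ p → c (suc p) ≢ nothing → lookup U p ∈ ys ++ ys′
    remaining p cp≢ with ∈-resp-↭ (shift x ys ys′) (c⊆zs (suc p) cp≢)
    ... | here eq    = contradiction (sym eq) (All.lookup x∉U (∈-lookup p))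
    ... | there u∈zs = u∈zs

  -- Double negation is applicative, so it passes through the finitely many choices of `p` and `i`.
  ¬¬-decide : (U : List X) (R : Fin t → List X) → ¬ ¬ (∀ p i → Dec (lookup U p ∈ R i))
  ¬¬-decide U R = sequence ¬¬-app λ p → sequence ¬¬-app λ i → ¬¬-excluded-middle
    where ¬¬-app = RawMonad.rawApplicative ¬¬-Monad

  -- A point of the cube encodes the random subset Y: elements of `P i` must lie in Y, those of
  -- `Q i` outside it, and all others are free.
  literal : {A B : Set ℓ} → Dec A → Dec B → Maybe Bool
  literal (yes _) _       = just true
  literal (no _)  (yes _) = just false
  literal (no _)  (no _)  = nothing

  cross-intersecting-bound : (P Q : Fin t → List X) →
    (∀ i → Disjointᴸ (P i) (Q i)) → (∀ i j → i ≢ j → ¬ Disjointᴸ (P i) (Q j)) →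
    t ^ t ≤ 2 ^ (∑[ i < t ] (length (P i) + length (Q i)))
  cross-intersecting-bound {t} P Q P∩Q≡∅ meet = decidable-stable (_ ≤? _) λ ¬bound →
    ¬¬-enumeration (concat (List.tabulate R)) λ (U , U! , R⊆U) →
    ¬¬-decide U P λ ∈P? → ¬¬-decide U Q λ ∈Q? → ¬bound (bound U U! R⊆U ∈P? ∈Q?)
    where
    R : Fin t → List X
    R i = P i ++ Q i

    module _ (U : List X) (U! : Unique U) (R⊆U : concat (List.tabulate R) ⊆ U)
             (∈P? : ∀ p i → Dec (lookup U p ∈ P i)) (∈Q? : ∀ p i → Dec (lookup U p ∈ Q i)) where

      c : Fin t → Subcube (length U)
      c i p = literal (∈P? p i) (∈Q? p i)

      codim≤ : ∀ i → codim (c i) ≤ length (P i) + length (Q i)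
      codim≤ i = subst (codim (c i) ≤_) (length-++ (P i)) (codim≤length U U! (c i) (R i) prescribed⇒∈)
        where
        prescribed⇒∈ : ∀ p → c i p ≢ nothing → lookup U p ∈ R i
        prescribed⇒∈ p cp≢ with ∈P? p i | ∈Q? p i
        ... | yes u∈P | _       = ∈-++⁺ˡ u∈P
        ... | no _    | yes u∈Q = ∈-++⁺ʳ (P i) u∈Q
        ... | no _    | no _    = contradiction refl cp≢

      c-true : ∀ i p → lookup U p ∈ P i → c i p ≡ just true
      c-true i p u∈P with ∈P? p i
      ... | yes _   = refl
      ... | no u∉P = contradiction u∈P u∉P

      c-false : ∀ i p → lookup U p ∈ Q i → c i p ≡ just false
      c-false i p u∈Q with ∈P? p i | ∈Q? p i
      -- `literal` tests `P i` first, so disjointness from `Q i` is what excludes this case.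
      ... | yes u∈P | _       = ⊥-elim (P∩Q≡∅ i (u∈P , u∈Q))
      ... | no _    | yes _   = refl
      ... | no _    | no u∉Q = contradiction u∈Q u∉Q

      exclusive : ∀ i j → i ≢ j → ∀ x → χ (c i) x ≢ 0 → χ (c j) x ≢ 0 → ⊥
      -- As the goal is `⊥`, non-disjointness may be used as if it supplied a common `v`. The
      -- coordinate of `v` is prescribed true by `c i` and false by `c j`.
      exclusive i j i≢j x χi≢0 χj≢0 = meet i j i≢j λ { {v} (v∈P , v∈Q) →
        let v∈U = R⊆U (∈-concat⁺′ (∈-++⁺ˡ v∈P) (∈-tabulate⁺ i))
            p   = index v∈U
            v≡u = lookup-index v∈U
        in clash (Vec.lookup x p)
             (subst (λ l → agrees l _ ≢ 0) (c-true i p (subst (_∈ P i) v≡u v∈P)) (χ≢0⇒agrees≢0 (c i) x χi≢0 p))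
             (subst (λ l → agrees l _ ≢ 0) (c-false j p (subst (_∈ Q j) v≡u v∈Q)) (χ≢0⇒agrees≢0 (c j) x χj≢0 p)) }
        where
        clash : ∀ b → agrees (just true) b ≢ 0 → agrees (just false) b ≢ 0 → ⊥
        clash true  _ h = h refl
        clash false h _ = h refl

      bound : t ^ t ≤ 2 ^ (∑[ i < t ] (length (P i) + length (Q i)))
      bound = ≤-trans (exclusive-subcubes-bound c exclusive) (^-monoʳ-≤ 2 (∑-mono-≤ codim≤))

-- Combining the bounds for cyclically consecutive positions

cyclic-bound : ∀ K (S : Fin (2 + n) → ℕ) → (∀ j k → j ≢ k → K ≤ 2 ^ (S j + S k)) →
  K ^ (2 + n) ≤ 2 ^ (2 ℕ.* sum S)
cyclic-bound {n} K S le = subst (λ e → K ^ (2 + n) ≤ 2 ^ e) cyclic-sum (^-sum-bound K g g-bound)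
  where
  open ≡-Reasoning

  g : Fin (2 + n) → ℕ
  -- Each index is paired with its cyclic predecessor, that of `zero` being the last index. For two
  -- positions the same pair occurs twice.
  g zero    = S (Fin.fromℕ (suc n)) + S zero
  g (suc j) = S (inject₁ j) + S (suc j)

  inject₁≢suc : ∀ {m} (j : Fin m) → inject₁ j ≢ suc j
  inject₁≢suc (suc j) eq = inject₁≢suc j (suc-injective eq)

  g-bound : ∀ j → K ≤ 2 ^ g j
  g-bound zero    = le (Fin.fromℕ (suc n)) zero λ ()
  g-bound (suc j) = le (inject₁ j) (suc j) (inject₁≢suc j)

  regroup : ∀ l z I T → l + z + (I + T) ≡ I + l + (z + T)
  regroup = solve-∀

  double : ∀ x → x + x ≡ 2 ℕ.* x
  double = solve-∀

  cyclic-sum : sum g ≡ 2 ℕ.* sum S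
  cyclic-sum = begin
    g zero + sum (g ∘ suc)
      ≡⟨ cong (λ z → g zero + z) (∑-distrib-+ (S ∘ inject₁) (S ∘ suc)) ⟩
    S (Fin.fromℕ (suc n)) + S zero + (sum (S ∘ inject₁) + sum (S ∘ suc))
      ≡⟨ regroup (S (Fin.fromℕ (suc n))) (S zero) (sum (S ∘ inject₁)) (sum (S ∘ suc)) ⟩
    sum (S ∘ inject₁) + S (Fin.fromℕ (suc n)) + sum S
      ≡⟨ cong (_+ sum S) (sum-init-last S) ⟨
    sum S + sum S
      ≡⟨ double (sum S) ⟩
    2 ℕ.* sum S ∎

-- Passage to the real logarithm

2^-cancel-< : ∀ {x y} → 2 ^ x < 2 ^ y → x < y
2^-cancel-< lt = ≰⇒> λ y≤x → <⇒≱ lt (^-monoʳ-≤ 2 y≤x)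

-- mkℚᵘ +[1+ e ] 1 is (e + 1) / 2.
log₂-bound : ∀ n .{{_ : NonZero n}} e S → n ^ suc e ≤ 2 ^ (2 ℕ.* S) →
  mkℚᵘ +[1+ e ] 1 • log₂ n ≤ℝ fromℕ S
log₂-bound n e S le {mkℚᵘ p k} lower = below p lower
  where
  open ≤-Reasoning

  -- The hypothesis is `lower` unfolded: 2p / ((e + 1)(k + 1)) lies below the logarithm of `n`, with
  -- denominators cleared. The factor 1 is `2 ^ 0`, from the negative part.
  nonNegative : ∀ p → 2 ^ (2 ℕ.* p) < n ^ (suc e ℕ.* suc k) ℕ.* 1 → p < S ℕ.* suc k
  nonNegative p lt = *-cancelˡ-< 2 _ _ $ 2^-cancel-< $ begin-strict
    2 ^ (2 ℕ.* p)                  <⟨ lt ⟩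
    n ^ (suc e ℕ.* suc k) ℕ.* 1    ≡⟨ *-identityʳ _ ⟩
    n ^ (suc e ℕ.* suc k)          ≡⟨ ^-*-assoc n (suc e) (suc k) ⟨
    (n ^ suc e) ^ suc k            ≤⟨ ^-monoˡ-≤ (suc k) le ⟩
    (2 ^ (2 ℕ.* S)) ^ suc k        ≡⟨ ^-*-assoc 2 (2 ℕ.* S) (suc k) ⟩
    2 ^ (2 ℕ.* S ℕ.* suc k)        ≡⟨ cong (2 ^_) (*-assoc 2 S (suc k)) ⟩
    2 ^ (2 ℕ.* (S ℕ.* suc k))      ∎

  cleared : ∀ p → p < S ℕ.* suc k → mkℚᵘ (+ p) k ℚ.< + S / 1
  cleared p lt = *<* $ subst₂ ℤ._<_ (sym (ℤ.*-identityʳ (+ p))) (ℤ.pos-* S (suc k)) (ℤ.+<+ lt)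

  below : ∀ p → Lower (mkℚᵘ +[1+ e ] 1 • log₂ n) (mkℚᵘ p k) → mkℚᵘ p k ℚ.< + S / 1
  -- The sign split lets `_⁺` and `_⁻` reduce. A negative rational is below `S` outright.
  below -[1+ p ] _  = *<* $ subst (-[1+ p ] ℤ.* ℤ.1ℤ ℤ.<_) (ℤ.pos-* S (suc k)) ℤ.-<+
  below +0       lt = cleared 0 (nonNegative 0 lt)
  below +[1+ p ] lt = cleared (suc p) (nonNegative (suc p) lt)

theorem7 : ∀ {ℓ} {X : Set ℓ} (d t : ℕ) (2≤d : 2 ≤ d) (2≤t : 2 ≤ t) (A : Fin t → Fin d → FinSet X) →
    (∀ i i′ j j′ → Disjoint (A i j) (A i′ j′) ⇔ (i ≡ i′ × j ≢ j′)) →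
    ((+ d / 2) * (+ t / 1)) • log₂ t {{>-nonZero (<⇒≤ 2≤t)}} ≤ℝ fromℕ (∑[ i < t ] ∑[ j < d ] ∣ A i j ∣)
-- Exposing successors in `d` and `t` makes the coefficient reduce to the positive numerator
-- `d ℕ.* t` over 2, the shape expected by `log₂-bound`.
theorem7 d@(suc (suc _)) t@(suc (suc _)) (s≤s (s≤s z≤n)) (s≤s (s≤s z≤n)) A A-disjoint =
  log₂-bound t _ _ $ begin
    t ^ (d ℕ.* t)                                ≡⟨ cong (t ^_) (*-comm d t) ⟩
    t ^ (t ℕ.* d)                                ≡⟨ ^-*-assoc t t d ⟨
    (t ^ t) ^ d                                  ≤⟨ cyclic-bound (t ^ t) S pair-bound ⟩
    2 ^ (2 ℕ.* sum S)                            ≡⟨ cong (λ z → 2 ^ (2 ℕ.* z)) (∑-comm (λ j i → ∣ A i j ∣)) ⟩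
    2 ^ (2 ℕ.* (∑[ i < t ] ∑[ j < d ] ∣ A i j ∣)) ∎
  where
  open ≤-Reasoning
  open Equivalence using (to; from)

  S : Fin d → ℕ
  S j = ∑[ i < t ] ∣ A i j ∣

  pair-bound : ∀ j k → j ≢ k → t ^ t ≤ 2 ^ (S j + S k)
  pair-bound j k j≢k = subst (λ z → t ^ t ≤ 2 ^ z) (∑-distrib-+ (λ i → ∣ A i j ∣) (λ i → ∣ A i k ∣)) $
    cross-intersecting-bound (λ i → elements (A i j)) (λ i → elements (A i k))
      (λ i → from (A-disjoint i i j k) (refl , j≢k))
      (λ i i′ i≢i′ disj → i≢i′ (proj₁ (to (A-disjoint i i′ j k) disj)))
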